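{- Let $\mathcal P\subset\mathbb R^d$ be an integral $d$-simplex with vertices $v_0,v_1,\ldots,v_d\in\mathbb Z^d$, and let $S$ be the set of all integer points $(\alpha,n)\in\mathbb Z^{d}\times\mathbb Z$ of the form $(\alpha,n)=\sum_{j=0}^d r_j(v_j,1)$ with $r_j\in\mathbb Q$ and $0\le r_j<1$ for all $j$. Then the following are equivalent: (i) the $\delta$-vector $\delta(\mathcal P)$ is shifted symmetric; (ii) every facet of $\mathcal P$ has normalized volume $1$; (iii) every element $(\alpha,n)\in S\setminus\{(0,\ldots,0,0)\}$ has a (unique) expression of the form $(\alpha,n)=\sum_{j=0}^d r_j(v_j,1)$ with $0<r_j<1$ for all $j=0,1,\ldots,d$.
   Context: For an integral convex polytope $\mathcal P\subset\mathbb R^N$ of dimension $d$, let $i(\mathcal P,n)=|n\mathcal P\cap\mathbb Z^N|$. The $\delta$-vector $\delta(\mathcal P)=(\delta_0,\ldots,\delta_d)$ is defined by $(1-\lambda)^{d+1}\bigl[1+\sum_{n\ge1}i(\mathcal P,n)\lambda^n\bigr]=\sum_{i=0}^d\delta_i\lambda^i$. The normalized volume of $\mathcal P$ is $\sum_{i=0}^d\delta_i$ (for a facet, computed with respect to its own dimension and lattice points). $\delta(\mathcal P)$ is called shifted symmetric if $\delta_{d-i}=\delta_{i+1}$ for every $0\le i\le\lfloor (d-1)/2\rfloor$. -}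

module Defs where

open import Data.Nat as ℕ using (ℕ; zero; suc; _∸_; ⌊_/2⌋)
open import Data.Nat.Combinatorics using (_C_)
open import Data.Integer as ℤ using (ℤ; +_)
open import Data.Rational as ℚ using (ℚ; 0ℚ; 1ℚ)
open import Data.Fin using (Fin; zero; suc; punchIn)
open import Data.Vec using (Vec; lookup; _∷_; []; replicate)
open import Data.List using (List; length)
open import Data.List.Membership.Propositional using (_∈_)
open import Data.List.Relation.Unary.Unique.Propositional using (Unique)
open import Data.Product using (Σ; _×_; ∃)
open import Relation.Binary.PropositionalEquality using (_≡_)
open import Relation.Nullary using (¬_)

ℤ→ℚ : ℤ → ℚ
ℤ→ℚ z = z ℚ./ 1

sumℚ : {m : ℕ} → (Fin m → ℚ) → ℚ
sumℚ {zero}  f = 0ℚ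
sumℚ {suc m} f = f zero ℚ.+ sumℚ (λ j → f (suc j))

sumℤ≤ : ℕ → (ℕ → ℤ) → ℤ
sumℤ≤ zero    f = f 0
sumℤ≤ (suc i) f = sumℤ≤ i f ℤ.+ f (suc i)

Verts : ℕ → ℕ → Set
Verts m N = Fin m → Vec ℤ N

InDilate : {m N : ℕ} → Verts m N → ℕ → Vec ℤ N → Set
InDilate {m} {N} w n x =
  Σ (Fin m → ℚ) λ r →
    (∀ j → 0ℚ ℚ.≤ r j) ×
    (sumℚ r ≡ ℤ→ℚ (+ n)) ×
    (∀ (i : Fin N) → sumℚ (λ j → r j ℚ.* ℤ→ℚ (lookup (w j) i)) ≡ ℤ→ℚ (lookup x i))

HasCard : {N : ℕ} → (Vec ℤ N → Set) → ℕ → Set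
HasCard {N} P k =
  Σ (List (Vec ℤ N)) λ xs →
    Unique xs × (length xs ≡ k) ×
    (∀ x → (x ∈ xs → P x) × (P x → x ∈ xs))

-- c is the Ehrhart function of conv(w): c n = i(conv w, n) = |n·conv(w) ∩ ℤ^N| for n ≥ 1.
-- (The value c 0 is never used: the generating series has constant term 1.)
IsEhrhart : {m N : ℕ} → Verts m N → (ℕ → ℕ) → Set
IsEhrhart w c = ∀ n → HasCard (InDilate w (suc n)) (c (suc n))

ehrSeries : (ℕ → ℕ) → ℕ → ℤ
ehrSeries c zero    = + 1
ehrSeries c (suc n) = + (c (suc n))

-- δ_i = coefficient of λ^i in (1-λ)^{e+1} [1 + Σ_{n≥1} i(P,n) λ^n]
--     = Σ_{k=0}^{i} (-1)^k binom(e+1,k) · (series coefficient at i-k),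
-- for a polytope of dimension e with Ehrhart function c.
delta : (ℕ → ℕ) → (e : ℕ) → ℕ → ℤ
delta c e i = sumℤ≤ i (λ k → sign k ℤ.* (+ ((suc e) C k)) ℤ.* ehrSeries c (i ∸ k))
  where
    sign : ℕ → ℤ
    sign zero          = + 1
    sign (suc zero)    = ℤ.- (+ 1)
    sign (suc (suc k)) = sign k

normVol : (ℕ → ℕ) → ℕ → ℤ
normVol c e = sumℤ≤ e (delta c e)

ShiftedSymmetric : (ℕ → ℤ) → ℕ → Set
ShiftedSymmetric δ d = ∀ i → i ℕ.≤ ⌊ (d ∸ 1) /2⌋ → δ (d ∸ i) ≡ δ (suc i)

-- v₀,…,v_d ∈ ℤ^d are the vertices of a d-simplex: (v_j,1) are linearly independent over ℚ.
IsSimplex : {d : ℕ} → Verts (suc d) d → Set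
IsSimplex {d} v =
  ∀ (r : Fin (suc d) → ℚ) →
    sumℚ r ≡ 0ℚ →
    (∀ (i : Fin d) → sumℚ (λ j → r j ℚ.* ℤ→ℚ (lookup (v j) i)) ≡ 0ℚ) →
    ∀ j → r j ≡ 0ℚ

facet : {d : ℕ} → Verts (suc d) d → Fin (suc d) → Verts d d
facet v k j = v (punchIn k j)

HasExpr : {d : ℕ} → Verts (suc d) d → (ℚ → Set) → Vec ℤ d → ℤ → Set
HasExpr {d} v Q α n =
  Σ (Fin (suc d) → ℚ) λ r →
    (∀ j → Q (r j)) ×
    (sumℚ r ≡ ℤ→ℚ n) ×
    (∀ (i : Fin d) → sumℚ (λ j → r j ℚ.* ℤ→ℚ (lookup (v j) i)) ≡ ℤ→ℚ (lookup α i))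

InS : {d : ℕ} → Verts (suc d) d → Vec ℤ d → ℤ → Set
InS v α n = HasExpr v (λ q → (0ℚ ℚ.≤ q) × (q ℚ.< 1ℚ)) α n

CondIII : {d : ℕ} → Verts (suc d) d → Set
CondIII {d} v =
  ∀ (α : Vec ℤ d) (n : ℤ) → InS v α n → ¬ ((α ≡ replicate d (+ 0)) × (n ≡ + 0)) →
    HasExpr v (λ q → (0ℚ ℚ.< q) × (q ℚ.< 1ℚ)) α n

{-# OPTIONS --safe #-}

-- Write (α , n) = Σⱼ rⱼ (vⱼ , 1). Bounding the coefficients r₀ , r₁ , … by 1 one after the other
-- multiplies the generating series of the cone by 1 − λ each time, because the points with rⱼ ≥ 1 are
-- the translates by (vⱼ , 1) of all points one level below. Hence δₙ is the number of points of S (the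
-- box) at height n. The box points with rₖ = 0 form the box of the k-th facet, so all facets have
-- normalized volume 1 iff every nonzero box point has full support. In that case r ↦ 1 − r exchanges
-- the heights n and d + 1 − n, and δ is shifted symmetric. Conversely, let δ be shifted symmetric, and
-- suppose that all box points of heights 1 , … , k have full support. A point of height d − k with some
-- rⱼ = 0 would have a negative (modulo the vertex lattice) of height in 1 , … , k without full support;
-- so height d − k has full support, and since δ_{d−k} = δ_{k+1} the reflection carries this to height
-- k + 1.
module Submission where

open import Defs
open import Data.Nat as ℕ using (ℕ; zero; suc; _+_; _≤_; _<_; _∸_; z≤n; s≤s; ⌊_/2⌋)
import Data.Nat.Properties as ℕₚ
open import Data.Nat.Combinatorics using (_C_; nCn≡1; nCk≡nC[n∸k]; k>n⇒nCk≡0; nCk+nC[k+1]≡[n+1]C[k+1])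
import Data.Nat.Coprimality as Coprimality
open import Data.Integer as ℤ using (ℤ; +_)
import Data.Integer.Properties as ℤₚ
open import Data.Integer.Solver renaming (module +-*-Solver to ℤ-Solver)
import Data.Sign as Sign
open import Data.Rational as ℚ using (ℚ; 0ℚ; 1ℚ)
import Data.Rational.Properties as ℚₚ
open import Data.Rational.Solver renaming (module +-*-Solver to ℚ-Solver)
open import Data.Fin using (Fin; zero; suc; toℕ; fromℕ<; punchIn; punchOut)
import Data.Fin.Properties as Finₚ
open import Data.Vec using (Vec; []; _∷_; lookup; tabulate; zipWith; replicate)
import Data.Vec.Properties as Vecₚ
import Data.Vec.Relation.Binary.Pointwise.Extensional as Pointwiseₚ
open import Data.Vec.Functional using (insertAt)
open import Data.Vec.Functional.Properties using (insertAt-lookup; insertAt-punchIn)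
open import Data.List using (List; []; _∷_; length; map; filter)
import Data.List.Properties as Listₚ
open import Data.List.Membership.Propositional using (_∈_)
open import Data.List.Membership.Propositional.Properties using (∈-filter⁺; ∈-filter⁻; ∈-map⁺; ∈-map⁻)
open import Data.List.Relation.Unary.Any as Any using (here; there)
import Data.List.Relation.Unary.All as All
import Data.List.Relation.Unary.All.Properties as Allₚ
open import Data.List.Relation.Unary.AllPairs using ([]; _∷_)
open import Data.List.Relation.Unary.Unique.Propositional using (Unique)
import Data.List.Relation.Unary.Unique.Propositional.Properties as Uniqueₚ
open import Data.Product using (Σ; ∃; ∃₂; _×_; _,_; proj₁; proj₂)
open import Data.Sum using (_⊎_; inj₁; inj₂)
open import Data.Empty using (⊥-elim)
open import Function using (_∘_)
open import Function.Bundles using (_⇔_; mk⇔)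
open import Relation.Binary.Definitions using (DecidableEquality)
open import Relation.Binary.PropositionalEquality using (_≡_; _≢_; refl; sym; trans; cong; cong₂; subst; subst₂; module ≡-Reasoning)
open import Relation.Nullary using (¬_; Dec; yes; no; ¬?)
open import Relation.Unary using (Decidable)

-- Integers inside the rationals

-- `z ℚ./ 1` is stuck on a variable `z`. In this normal form numerator and denominator compute, so
-- arithmetic and order pass to the integers.
ℤ→ℚ-mkℚ : ∀ z → ℤ→ℚ z ≡ ℚ.mkℚ z 0 (Coprimality.sym (Coprimality.1-coprimeTo ℤ.∣ z ∣))
ℤ→ℚ-mkℚ z = ℚₚ.↥p/↧p≡p (ℚ.mkℚ z 0 (Coprimality.sym (Coprimality.1-coprimeTo ℤ.∣ z ∣)))

↥-ℤ→ℚ : ∀ z → ℚ.↥ (ℤ→ℚ z) ≡ z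
↥-ℤ→ℚ z = cong ℚ.↥_ (ℤ→ℚ-mkℚ z)

ℤ→ℚ-injective : ∀ {a b} → ℤ→ℚ a ≡ ℤ→ℚ b → a ≡ b
ℤ→ℚ-injective {a} {b} eq = trans (sym (↥-ℤ→ℚ a)) (trans (cong ℚ.↥_ eq) (↥-ℤ→ℚ b))

ℤ→ℚ-+ : ∀ a b → ℤ→ℚ (a ℤ.+ b) ≡ ℤ→ℚ a ℚ.+ ℤ→ℚ b
ℤ→ℚ-+ a b = sym (trans (cong₂ ℚ._+_ (ℤ→ℚ-mkℚ a) (ℤ→ℚ-mkℚ b))
  (cong (λ z → z ℚ./ 1) (cong₂ ℤ._+_ (ℤₚ.*-identityʳ a) (ℤₚ.*-identityʳ b))))

ℤ→ℚ-* : ∀ a b → ℤ→ℚ (a ℤ.* b) ≡ ℤ→ℚ a ℚ.* ℤ→ℚ b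
ℤ→ℚ-* a b = sym (cong₂ ℚ._*_ (ℤ→ℚ-mkℚ a) (ℤ→ℚ-mkℚ b))

p+q-q≡p : ∀ p q → p ℚ.+ q ℚ.- q ≡ p
p+q-q≡p = solve 2 (λ p q → p :+ q :- q := p) refl
  where open ℚ-Solver

a-b+b≡a : ∀ a b → a ℤ.- b ℤ.+ b ≡ a
a-b+b≡a = solve 2 (λ a b → a :- b :+ b := a) refl
  where open ℤ-Solver

ℤ→ℚ-- : ∀ a b → ℤ→ℚ (a ℤ.- b) ≡ ℤ→ℚ a ℚ.- ℤ→ℚ b
ℤ→ℚ-- a b = begin
  ℤ→ℚ (a ℤ.- b)                         ≡⟨ p+q-q≡p _ (ℤ→ℚ b) ⟨
  ℤ→ℚ (a ℤ.- b) ℚ.+ ℤ→ℚ b ℚ.- ℤ→ℚ b     ≡⟨ cong (ℚ._- ℤ→ℚ b) (ℤ→ℚ-+ (a ℤ.- b) b) ⟨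
  ℤ→ℚ (a ℤ.- b ℤ.+ b) ℚ.- ℤ→ℚ b         ≡⟨ cong (λ z → ℤ→ℚ z ℚ.- ℤ→ℚ b) (a-b+b≡a a b) ⟩
  ℤ→ℚ a ℚ.- ℤ→ℚ b                       ∎
  where open ≡-Reasoning

ℤ→ℚ-reflects-≤ : ∀ {a b} → ℤ→ℚ a ℚ.≤ ℤ→ℚ b → a ℤ.≤ b
ℤ→ℚ-reflects-≤ {a} {b} le =
  subst₂ ℤ._≤_ (ℤₚ.*-identityʳ a) (ℤₚ.*-identityʳ b)
    (ℚₚ.drop-*≤* (subst₂ ℚ._≤_ (ℤ→ℚ-mkℚ a) (ℤ→ℚ-mkℚ b) le))

ℤ→ℚ-reflects-< : ∀ {a b} → ℤ→ℚ a ℚ.< ℤ→ℚ b → a ℤ.< b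
ℤ→ℚ-reflects-< {a} {b} lt =
  subst₂ ℤ._<_ (ℤₚ.*-identityʳ a) (ℤₚ.*-identityʳ b)
    (ℚₚ.drop-*<* (subst₂ ℚ._<_ (ℤ→ℚ-mkℚ a) (ℤ→ℚ-mkℚ b) lt))

<⇒≱ : ∀ {p q} → p ℚ.< q → ¬ (q ℚ.≤ p)
<⇒≱ p<q q≤p = ℚₚ.<-irrefl refl (ℚₚ.<-≤-trans p<q q≤p)

0≤∧≯0⇒≡0 : ∀ {q} → 0ℚ ℚ.≤ q → ¬ (0ℚ ℚ.< q) → q ≡ 0ℚ
0≤∧≯0⇒≡0 0≤q 0≮q = ℚₚ.≤-antisym (ℚₚ.≮⇒≥ 0≮q) 0≤q

0≤q-p : ∀ {p q} → p ℚ.≤ q → 0ℚ ℚ.≤ q ℚ.- p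
0≤q-p {p} {q} le = subst (ℚ._≤ q ℚ.- p) (ℚₚ.+-inverseʳ p) (ℚₚ.+-monoˡ-≤ (ℚ.- p) le)

0<q-p : ∀ {p q} → p ℚ.< q → 0ℚ ℚ.< q ℚ.- p
0<q-p {p} {q} lt = subst (ℚ._< q ℚ.- p) (ℚₚ.+-inverseʳ p) (ℚₚ.+-monoˡ-< (ℚ.- p) lt)

q-p<q : ∀ {p q} → 0ℚ ℚ.< p → q ℚ.- p ℚ.< q
q-p<q {p} {q} lt = subst (q ℚ.- p ℚ.<_) (ℚₚ.+-identityʳ q) (ℚₚ.+-monoʳ-< q (ℚₚ.neg-antimono-< lt))

q-0≡q : ∀ q → q ℚ.- 0ℚ ≡ q
q-0≡q = solve 1 (λ q → q :- con 0ℚ := q) refl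
  where open ℚ-Solver

q-p≡0⇒q≡p : ∀ {p q} → q ℚ.- p ≡ 0ℚ → q ≡ p
q-p≡0⇒q≡p {p} {q} eq = begin
  q               ≡⟨ solve 2 (λ q p → q := q :- p :+ p) refl q p ⟩
  q ℚ.- p ℚ.+ p   ≡⟨ cong (ℚ._+ p) eq ⟩
  0ℚ ℚ.+ p        ≡⟨ ℚₚ.+-identityˡ p ⟩
  p               ∎
  where
  open ≡-Reasoning
  open ℚ-Solver

-- Finite sums

sumℚ-cong : ∀ {m} {f g : Fin m → ℚ} → (∀ j → f j ≡ g j) → sumℚ f ≡ sumℚ g
sumℚ-cong {zero}  eq = refl
sumℚ-cong {suc m} eq = cong₂ ℚ._+_ (eq zero) (sumℚ-cong (eq ∘ suc))

sumℚ-+ : ∀ {m} (f g : Fin m → ℚ) → sumℚ (λ j → f j ℚ.+ g j) ≡ sumℚ f ℚ.+ sumℚ g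
sumℚ-+ {zero}  f g = refl
sumℚ-+ {suc m} f g = trans (cong (f zero ℚ.+ g zero ℚ.+_) (sumℚ-+ (f ∘ suc) (g ∘ suc)))
  (solve 4 (λ a b c d → a :+ b :+ (c :+ d) := a :+ c :+ (b :+ d)) refl (f zero) (g zero) _ _)
  where open ℚ-Solver

sumℚ-- : ∀ {m} (f g : Fin m → ℚ) → sumℚ (λ j → f j ℚ.- g j) ≡ sumℚ f ℚ.- sumℚ g
sumℚ-- {zero}  f g = refl
sumℚ-- {suc m} f g = trans (cong (f zero ℚ.- g zero ℚ.+_) (sumℚ-- (f ∘ suc) (g ∘ suc)))
  (solve 4 (λ a b c d → a :- b :+ (c :- d) := a :+ c :- (b :+ d)) refl (f zero) (g zero) _ _)
  where open ℚ-Solver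

sumℚ-punchIn : ∀ {m} (k : Fin (suc m)) (f : Fin (suc m) → ℚ) →
  sumℚ f ≡ f k ℚ.+ sumℚ (f ∘ punchIn k)
sumℚ-punchIn         zero    f = refl
sumℚ-punchIn {suc m} (suc k) f = trans (cong (f zero ℚ.+_) (sumℚ-punchIn k (f ∘ suc)))
  (solve 3 (λ a b c → a :+ (b :+ c) := b :+ (a :+ c)) refl (f zero) (f (suc k)) _)
  where open ℚ-Solver

sumℚ-mono-≤ : ∀ {m} {f g : Fin m → ℚ} → (∀ j → f j ℚ.≤ g j) → sumℚ f ℚ.≤ sumℚ g
sumℚ-mono-≤ {zero}  le = ℚₚ.≤-refl
sumℚ-mono-≤ {suc m} le = ℚₚ.+-mono-≤ (le zero) (sumℚ-mono-≤ (le ∘ suc))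

sumℚ-mono-< : ∀ {m} {f g : Fin m → ℚ} → (∀ j → f j ℚ.≤ g j) → ∀ k → f k ℚ.< g k → sumℚ f ℚ.< sumℚ g
sumℚ-mono-< le zero    lt = ℚₚ.+-mono-<-≤ lt (sumℚ-mono-≤ (le ∘ suc))
sumℚ-mono-< le (suc k) lt = ℚₚ.+-mono-≤-< (le zero) (sumℚ-mono-< (le ∘ suc) k lt)

sumℤ : ∀ {m} → (Fin m → ℤ) → ℤ
sumℤ {zero}  f = + 0
sumℤ {suc m} f = f zero ℤ.+ sumℤ (f ∘ suc)

sumℚ-ℤ→ℚ : ∀ {m} (f : Fin m → ℤ) → sumℚ (ℤ→ℚ ∘ f) ≡ ℤ→ℚ (sumℤ f)
sumℚ-ℤ→ℚ {zero}  f = refl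
sumℚ-ℤ→ℚ {suc m} f = trans (cong (ℤ→ℚ (f zero) ℚ.+_) (sumℚ-ℤ→ℚ (f ∘ suc))) (sym (ℤ→ℚ-+ (f zero) _))

sumℤ-const-0 : ∀ m → sumℤ {m} (λ _ → + 0) ≡ + 0
sumℤ-const-0 zero    = refl
sumℤ-const-0 (suc m) = trans (ℤₚ.+-identityˡ _) (sumℤ-const-0 m)

sumℤ-const-1 : ∀ m → sumℤ {m} (λ _ → + 1) ≡ + m
sumℤ-const-1 zero    = refl
sumℤ-const-1 (suc m) = cong (ℤ._+_ (+ 1)) (sumℤ-const-1 m)

sumℚ-const-0 : ∀ m → sumℚ {m} (λ _ → 0ℚ) ≡ 0ℚ
sumℚ-const-0 m = trans (sumℚ-ℤ→ℚ {m} (λ _ → + 0)) (cong ℤ→ℚ (sumℤ-const-0 m))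

sumℚ-const-1 : ∀ m → sumℚ {m} (λ _ → 1ℚ) ≡ ℤ→ℚ (+ m)
sumℚ-const-1 m = trans (sumℚ-ℤ→ℚ {m} (λ _ → + 1)) (cong ℤ→ℚ (sumℤ-const-1 m))

sumℚ-zero⇒≡0 : ∀ {m} {r : Fin m → ℚ} → (∀ j → 0ℚ ℚ.≤ r j) → sumℚ r ≡ 0ℚ → ∀ j → r j ≡ 0ℚ
sumℚ-zero⇒≡0 {m} {r} 0≤r eq j with 0ℚ ℚₚ.<? r j
... | no  0≮r = 0≤∧≯0⇒≡0 (0≤r j) 0≮r
... | yes 0<r = ⊥-elim (ℚₚ.<⇒≢ (sumℚ-mono-< {f = λ _ → 0ℚ} 0≤r j 0<r)
  (trans (sumℚ-const-0 m) (sym eq)))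

sumℤ≤-cong : ∀ n {f g} → (∀ k → f k ≡ g k) → sumℤ≤ n f ≡ sumℤ≤ n g
sumℤ≤-cong zero    eq = eq 0
sumℤ≤-cong (suc n) eq = cong₂ ℤ._+_ (sumℤ≤-cong n eq) (eq (suc n))

sumℤ≤-head : ∀ n f → sumℤ≤ (suc n) f ≡ f 0 ℤ.+ sumℤ≤ n (f ∘ suc)
sumℤ≤-head zero    f = refl
sumℤ≤-head (suc n) f = trans (cong (ℤ._+ f (suc (suc n))) (sumℤ≤-head n f)) (ℤₚ.+-assoc (f 0) _ _)

sumℤ≤-- : ∀ n f g → sumℤ≤ n (λ k → f k ℤ.- g k) ≡ sumℤ≤ n f ℤ.- sumℤ≤ n g
sumℤ≤-- zero    f g = refl
sumℤ≤-- (suc n) f g = trans (cong (ℤ._+ (f (suc n) ℤ.- g (suc n))) (sumℤ≤-- n f g))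
  (solve 4 (λ a b c d → a :- b :+ (c :- d) := a :+ c :- (b :+ d)) refl
    (sumℤ≤ n f) (sumℤ≤ n g) (f (suc n)) (g (suc n)))
  where open ℤ-Solver

sumℤ≤-zero : ∀ n {f} → (∀ k → f k ≡ + 0) → sumℤ≤ n f ≡ + 0
sumℤ≤-zero zero    eq = eq 0
sumℤ≤-zero (suc n) eq = cong₂ ℤ._+_ (sumℤ≤-zero n eq) (eq (suc n))

-- The δ-vector as an iterated difference

-- The coefficients of (1 − λ) g(λ).
diff : (ℕ → ℤ) → ℕ → ℤ
diff g zero    = g zero
diff g (suc n) = g (suc n) ℤ.- g n

diffs : ℕ → (ℕ → ℤ) → ℕ → ℤ
diffs zero    g = g
diffs (suc t) g = diff (diffs t g)

nC0≡1 : ∀ n → n C 0 ≡ 1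
nC0≡1 n = trans (nCk≡nC[n∸k] {0} {n} z≤n) (nCn≡1 n)

module AlternatingSum (sg : ℕ → ℤ) (sg0 : sg 0 ≡ + 1) (sg1 : sg 1 ≡ ℤ.- (+ 1))
                      (sg2 : ∀ k → sg (suc (suc k)) ≡ sg k) (g : ℕ → ℤ) where

  sg-suc : ∀ k → sg (suc k) ≡ ℤ.- sg k
  sg-suc zero    = trans sg1 (cong ℤ.-_ (sym sg0))
  sg-suc (suc k) = trans (sg2 k) (trans (sym (ℤₚ.neg-involutive (sg k))) (cong ℤ.-_ (sym (sg-suc k))))

  term : ℕ → ℕ → ℕ → ℤ
  term m i k = sg k ℤ.* (+ (m C k)) ℤ.* g (i ∸ k)

  term-0 : ∀ m i → term m i 0 ≡ g i
  term-0 m i rewrite nC0≡1 m | sg0 = ℤₚ.*-identityˡ (g i)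

  -- The alternating sign turns Pascal's rule into a difference. Since `suc i ∸ suc k` reduces to
  -- `i ∸ k`, all three terms carry the same value of `g`.
  pascal : ∀ m i k → term (suc m) (suc i) (suc k) ≡ term m (suc i) (suc k) ℤ.- term m i k
  pascal m i k = begin
    sg (suc k) ℤ.* (+ (suc m C suc k)) ℤ.* G
      ≡⟨ cong (λ c → sg (suc k) ℤ.* (+ c) ℤ.* G) (nCk+nC[k+1]≡[n+1]C[k+1] m k) ⟨
    sg (suc k) ℤ.* (+ (m C k) ℤ.+ + (m C suc k)) ℤ.* G
      ≡⟨ solve 4 (λ s a b x → s :* (a :+ b) :* x := s :* b :* x :- (:- s) :* a :* x) refl
           (sg (suc k)) (+ (m C k)) (+ (m C suc k)) G ⟩
    term m (suc i) (suc k) ℤ.- (ℤ.- sg (suc k)) ℤ.* (+ (m C k)) ℤ.* G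
      ≡⟨ cong (λ s → term m (suc i) (suc k) ℤ.- s ℤ.* (+ (m C k)) ℤ.* G)
           (trans (cong ℤ.-_ (sg-suc k)) (ℤₚ.neg-involutive (sg k))) ⟩
    term m (suc i) (suc k) ℤ.- term m i k
      ∎
    where
    open ≡-Reasoning
    open ℤ-Solver
    G = g (i ∸ k)

  -- Induction on `m`: by `pascal`, one more factor 1 - λ is one more `diff`.
  sum≡diffs : ∀ m i → sumℤ≤ i (term m i) ≡ diffs m g i
  sum≡diffs zero zero = term-0 0 0
  sum≡diffs zero (suc i) = begin
    sumℤ≤ (suc i) (term 0 (suc i))                            ≡⟨ sumℤ≤-head i (term 0 (suc i)) ⟩
    term 0 (suc i) 0 ℤ.+ sumℤ≤ i (term 0 (suc i) ∘ suc)       ≡⟨ cong₂ ℤ._+_ (term-0 0 (suc i)) (sumℤ≤-zero i vanish) ⟩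
    g (suc i) ℤ.+ + 0                                         ≡⟨ ℤₚ.+-identityʳ _ ⟩
    g (suc i)                                                 ∎
    where
    open ≡-Reasoning
    vanish : ∀ k → term 0 (suc i) (suc k) ≡ + 0
    vanish k rewrite k>n⇒nCk≡0 {0} {suc k} (s≤s z≤n) | ℤₚ.*-zeroʳ (sg (suc k)) = refl
  sum≡diffs (suc m) zero = trans (term-0 (suc m) 0) (trans (sym (term-0 m 0)) (sum≡diffs m 0))
  sum≡diffs (suc m) (suc i) = begin
    sumℤ≤ (suc i) (term (suc m) (suc i))
      ≡⟨ sumℤ≤-head i (term (suc m) (suc i)) ⟩
    term (suc m) (suc i) 0 ℤ.+ sumℤ≤ i (term (suc m) (suc i) ∘ suc)
      ≡⟨ cong₂ ℤ._+_ (trans (term-0 (suc m) (suc i)) (sym (term-0 m (suc i)))) (sumℤ≤-cong i (pascal m i)) ⟩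
    term m (suc i) 0 ℤ.+ sumℤ≤ i (λ k → term m (suc i) (suc k) ℤ.- term m i k)
      ≡⟨ cong (ℤ._+_ (term m (suc i) 0)) (sumℤ≤-- i (term m (suc i) ∘ suc) (term m i)) ⟩
    term m (suc i) 0 ℤ.+ (sumℤ≤ i (term m (suc i) ∘ suc) ℤ.- sumℤ≤ i (term m i))
      ≡⟨ ℤₚ.+-assoc (term m (suc i) 0) _ _ ⟨
    term m (suc i) 0 ℤ.+ sumℤ≤ i (term m (suc i) ∘ suc) ℤ.- sumℤ≤ i (term m i)
      ≡⟨ cong (ℤ._- sumℤ≤ i (term m i)) (sumℤ≤-head i (term m (suc i))) ⟨
    sumℤ≤ (suc i) (term m (suc i)) ℤ.- sumℤ≤ i (term m i)
      ≡⟨ cong₂ ℤ._-_ (sum≡diffs m (suc i)) (sum≡diffs m i) ⟩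
    diffs m g (suc i) ℤ.- diffs m g i
      ∎
    where open ≡-Reasoning

  -- The summand of delta with ∣_∣ replaced by a variable, in the shape to which Agda normalises it.
  sum≡diffs′ : ∀ (abs : ℤ → ℕ) → ℤ.∣_∣ ≡ abs → ∀ m i {x} →
    (let _·_ : ℤ → ℕ → ℤ
         s · n = (ℤ.sign s Sign.* Sign.+) ℤ.◃ (abs s ℕ.* n)
         _⋆_ : ℤ → ℤ → ℤ
         s ⋆ t = (ℤ.sign s Sign.* ℤ.sign t) ℤ.◃ (abs s ℕ.* abs t)
     in x ≡ sumℤ≤ i (λ k → (sg k · (m C k)) ⋆ g (i ∸ k))) →
    x ≡ diffs m g i
  sum≡diffs′ _ refl m i eq = trans eq (sum≡diffs m i)

-- The sign function is local to delta, so it has to be found by unification. That requires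
-- ∣_∣ to be a variable: ∣ s ∣ = ∣ t ∣ does not determine s, but abs s = abs t does.
≡delta⇒≡diffs : ∀ c e i {x} → x ≡ delta c e i → x ≡ diffs (suc e) (ehrSeries c) i
≡delta⇒≡diffs c e i x≡delta with ℤ.∣_∣ in abs-eq | x≡delta
... | abs | eq = AlternatingSum.sum≡diffs′ _ refl refl (λ _ → refl) (ehrSeries c) abs abs-eq (suc e) i eq

delta≡diffs : ∀ c e i → delta c e i ≡ diffs (suc e) (ehrSeries c) i
delta≡diffs c e i = ≡delta⇒≡diffs c e i refl

-- Cardinalities

_≟ᵛ_ : ∀ {N} → DecidableEquality (Vec ℤ N)
_≟ᵛ_ = Vecₚ.≡-dec ℤₚ._≟_

_∈?_ : ∀ {N} (x : Vec ℤ N) xs → Dec (x ∈ xs)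
x ∈? xs = Any.any? (x ≟ᵛ_) xs

-- Induction on `xs`: deleting all copies of the head from `ys` shortens `ys` strictly and still
-- leaves the tail of `xs` contained in it.
length-mono-⊆ : ∀ {N} {xs ys : List (Vec ℤ N)} → Unique xs →
  (∀ {x} → x ∈ xs → x ∈ ys) → length xs ≤ length ys
length-mono-⊆ {xs = []} _ _ = z≤n
length-mono-⊆ {xs = x ∷ xs} {ys} (x∉ ∷ uniq) sub = ℕₚ.≤-<-trans
  (length-mono-⊆ uniq λ {y} y∈ → ∈-filter⁺ ≢x? (sub (there y∈)) (All.lookup x∉ y∈))
  (Listₚ.filter-notAll ≢x? ys (Any.map (λ x≡y x≢y → x≢y x≡y) (sub (here refl))))
  where
  ≢x? : Decidable (x ≢_)
  ≢x? y = ¬? (x ≟ᵛ y)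

-- A missing `y` could be put in front of `xs`, making a repetition-free list inside `ys` that is
-- too long.
⊆∧length≥⇒⊇ : ∀ {N} {xs ys : List (Vec ℤ N)} → Unique xs → (∀ {x} → x ∈ xs → x ∈ ys) →
  length ys ≤ length xs → ∀ {y} → y ∈ ys → y ∈ xs
⊆∧length≥⇒⊇ {xs = xs} {ys} uniq sub le {y} y∈ with y ∈? xs
... | yes y∈xs = y∈xs
... | no  y∉xs = ⊥-elim (ℕₚ.<⇒≱ (length-mono-⊆ (Allₚ.¬Any⇒All¬ xs y∉xs ∷ uniq) sub′) le)
  where
  sub′ : ∀ {x} → x ∈ y ∷ xs → x ∈ ys
  sub′ (here refl) = y∈
  sub′ (there x∈)  = sub x∈

HasCard-unique : ∀ {N k l} {P : Vec ℤ N → Set} → HasCard P k → HasCard P l → k ≡ l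
HasCard-unique (xs , ux , refl , ex) (ys , uy , refl , ey) = ℕₚ.≤-antisym
  (length-mono-⊆ ux λ {x} x∈ → proj₂ (ey x) (proj₁ (ex x) x∈))
  (length-mono-⊆ uy λ {y} y∈ → proj₂ (ex y) (proj₁ (ey y) y∈))

module _ {N : ℕ} {P Q : Vec ℤ N → Set} where

  HasCard-map : ∀ {k} (φ ψ : Vec ℤ N → Vec ℤ N) → (∀ x → ψ (φ x) ≡ x) → (∀ y → φ (ψ y) ≡ y) →
    (∀ {x} → P x → Q (φ x)) → (∀ {y} → Q y → P (ψ y)) → HasCard P k → HasCard Q k
  HasCard-map φ ψ ψφ φψ p⇒q q⇒p (xs , uniq , refl , ex) =
    map φ xs , Uniqueₚ.map⁺ (λ {x} {y} eq → trans (sym (ψφ x)) (trans (cong ψ eq) (ψφ y))) uniq ,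
    Listₚ.length-map φ xs , λ y → to y , from y
    where
    to : ∀ y → y ∈ map φ xs → Q y
    to y y∈ with x , x∈ , refl ← ∈-map⁻ φ y∈ = p⇒q (proj₁ (ex x) x∈)
    from : ∀ y → Q y → y ∈ map φ xs
    from y q = subst (_∈ map φ xs) (φψ y) (∈-map⁺ φ (proj₂ (ex (ψ y)) (q⇒p q)))

  -- Pigeonhole: the image of the enumeration of `P` is repetition-free, lies in the enumeration of
  -- `Q` and is equally long.
  injection-surjective : ∀ {k} (φ : Vec ℤ N → Vec ℤ N) → (∀ {x y} → φ x ≡ φ y → x ≡ y) →
    (∀ {x} → P x → Q (φ x)) → HasCard P k → HasCard Q k → ∀ {y} → Q y → ∃ λ x → P x × y ≡ φ x
  injection-surjective φ inj p⇒q (xs , ux , refl , ex) (ys , _ , len , ey) {y} q =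
    let x , x∈ , eq = ∈-map⁻ φ (⊆∧length≥⇒⊇ (Uniqueₚ.map⁺ inj ux) sub
                        (ℕₚ.≤-reflexive (trans len (sym (Listₚ.length-map φ xs)))) (proj₂ (ey y) q))
    in x , proj₁ (ex x) x∈ , eq
    where
    sub : ∀ {z} → z ∈ map φ xs → z ∈ ys
    sub z∈ with x , x∈ , refl ← ∈-map⁻ φ z∈ = proj₂ (ey (φ x)) (p⇒q (proj₁ (ex x) x∈))

HasCard-∅ : ∀ {N k} {P : Vec ℤ N → Set} → (∀ {x} → ¬ P x) → HasCard P k → k ≡ 0
HasCard-∅ ¬p ([]     , _ , refl , _)  = refl
HasCard-∅ ¬p (x ∷ xs , _ , refl , ex) = ⊥-elim (¬p (proj₁ (ex x) (here refl)))

HasCard-0⇒∅ : ∀ {N} {P : Vec ℤ N → Set} → HasCard P 0 → ∀ {x} → ¬ P x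
HasCard-0⇒∅ ([] , _ , refl , ex) {x} p with () ← proj₂ (ex x) p

length-filter-¬ : ∀ {A : Set} {P : A → Set} (P? : Decidable P) xs →
  length (filter P? xs) + length (filter (¬? ∘ P?) xs) ≡ length xs
length-filter-¬ P? []       = refl
length-filter-¬ P? (x ∷ xs) with P? x
... | yes _ = cong suc (length-filter-¬ P? xs)
... | no  _ = trans (ℕₚ.+-suc _ _) (cong suc (length-filter-¬ P? xs))

HasCard-split : ∀ {N k} {P Q R : Vec ℤ N → Set} → (∀ {x} → P x → Q x ⊎ R x) →
  (∀ {x} → Q x → P x) → (∀ {x} → R x → P x) → (∀ {x} → Q x → ¬ R x) →
  HasCard P k → ∃₂ λ a b → HasCard Q a × HasCard R b × a + b ≡ k
HasCard-split {N} {P = P} {Q} {R} p⇒ q⇒p r⇒p q⇒¬r (xs , uniq , len , ex) =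
  _ , _ ,
  (filter Q? xs , Uniqueₚ.filter⁺ Q? uniq , refl ,
    λ x → proj₂ ∘ ∈-filter⁻ Q? {xs = xs} , λ q → ∈-filter⁺ Q? (proj₂ (ex x) (q⇒p q)) q) ,
  (filter (¬? ∘ Q?) xs , Uniqueₚ.filter⁺ (¬? ∘ Q?) uniq , refl ,
    λ x → toR , λ r → ∈-filter⁺ (¬? ∘ Q?) (proj₂ (ex x) (r⇒p r)) (λ q → q⇒¬r q r)) ,
  trans (length-filter-¬ Q? xs) len
  where
  -- Decidability of `Q` comes from the enumeration: a point outside `xs` fails `P`, hence `Q`, and
  -- a listed one is sorted by `p⇒`.
  Q? : Decidable Q
  Q? x with x ∈? xs
  ... | no  x∉ = no λ q → x∉ (proj₂ (ex x) (q⇒p q))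
  ... | yes x∈ with p⇒ (proj₁ (ex x) x∈)
  ...   | inj₁ q = yes q
  ...   | inj₂ r = no λ q → q⇒¬r q r
  toR : ∀ {x} → x ∈ filter (¬? ∘ Q?) xs → R x
  toR {x} x∈ with ∈-filter⁻ (¬? ∘ Q?) {xs = xs} x∈
  ... | x∈xs , ¬q with p⇒ (proj₁ (ex x) x∈xs)
  ...   | inj₁ q = ⊥-elim (¬q q)
  ...   | inj₂ r = r

-- Lattice points in a cone

infixl 6 _⊕_ _⊖_

_⊕_ _⊖_ : ∀ {N} → Vec ℤ N → Vec ℤ N → Vec ℤ N
_⊕_ = zipWith ℤ._+_
_⊖_ = zipWith ℤ._-_

⊖-⊕ : ∀ {N} (x y : Vec ℤ N) → x ⊖ y ⊕ y ≡ x
⊖-⊕ []      []      = refl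
⊖-⊕ (a ∷ x) (b ∷ y) = cong₂ _∷_ (a-b+b≡a a b) (⊖-⊕ x y)

⊕-⊖ : ∀ {N} (x y : Vec ℤ N) → x ⊕ y ⊖ y ≡ x
⊕-⊖ []      []      = refl
⊕-⊖ (a ∷ x) (b ∷ y) = cong₂ _∷_ (solve 2 (λ a b → a :+ b :- b := a) refl a b) (⊕-⊖ x y)
  where open ℤ-Solver

⊖-⊖ : ∀ {N} (x y : Vec ℤ N) → x ⊖ (x ⊖ y) ≡ y
⊖-⊖ []      []      = refl
⊖-⊖ (a ∷ x) (b ∷ y) = cong₂ _∷_ (solve 2 (λ a b → a :- (a :- b) := b) refl a b) (⊖-⊖ x y)
  where open ℤ-Solver

-- (x , n) = Σⱼ rⱼ (wⱼ , 1)
record Rep {m N : ℕ} (w : Verts m N) (r : Fin m → ℚ) (n : ℤ) (x : Vec ℤ N) : Set where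
  constructor rep
  field
    height : sumℚ r ≡ ℤ→ℚ n
    coords : ∀ i → sumℚ (λ j → r j ℚ.* ℤ→ℚ (lookup (w j) i)) ≡ ℤ→ℚ (lookup x i)

open Rep

-- `IsSimplex` for any number of vertices in any dimension, so that it also applies to facets; for d
-- + 1 vertices in dimension d the two agree definitionally.
Independent : ∀ {m N} → Verts m N → Set
Independent {m} {N} w = ∀ (r : Fin m → ℚ) → sumℚ r ≡ 0ℚ →
  (∀ (i : Fin N) → sumℚ (λ j → r j ℚ.* ℤ→ℚ (lookup (w j) i)) ≡ 0ℚ) → ∀ j → r j ≡ 0ℚ

-- Serves for all lattice shifts below: by a single vertex (`unit k`), by the sum of all vertices,
-- and by the vertices in the support of a point.
comb : ∀ {m N} → Verts m N → (Fin m → ℤ) → Vec ℤ N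
comb w e = tabulate λ i → sumℤ λ j → e j ℤ.* lookup (w j) i

unit : ∀ {m} → Fin m → Fin m → ℤ
unit zero    zero    = + 1
unit zero    (suc j) = + 0
unit (suc k) zero    = + 0
unit (suc k) (suc j) = unit k j

unit-≡ : ∀ {m} (k : Fin m) → unit k k ≡ + 1
unit-≡ zero    = refl
unit-≡ (suc k) = unit-≡ k

unit-≢ : ∀ {m} (k j : Fin m) → j ≢ k → unit k j ≡ + 0
unit-≢ zero    zero    j≢k = ⊥-elim (j≢k refl)
unit-≢ zero    (suc j) j≢k = refl
unit-≢ (suc k) zero    j≢k = refl
unit-≢ (suc k) (suc j) j≢k = unit-≢ k j (j≢k ∘ cong suc)

sumℤ-unit : ∀ {m} (k : Fin m) → sumℤ (unit k) ≡ + 1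
sumℤ-unit {suc m} zero    = cong (ℤ._+_ (+ 1)) (sumℤ-const-0 m)
sumℤ-unit {suc m} (suc k) = trans (ℤₚ.+-identityˡ _) (sumℤ-unit k)

module _ {m N : ℕ} {w : Verts m N} where

  Rep-comb : ∀ e → Rep w (ℤ→ℚ ∘ e) (sumℤ e) (comb w e)
  Rep-comb e .height   = sumℚ-ℤ→ℚ e
  Rep-comb e .coords i = begin
    sumℚ (λ j → ℤ→ℚ (e j) ℚ.* ℤ→ℚ (lookup (w j) i))   ≡⟨ sumℚ-cong (λ j → sym (ℤ→ℚ-* (e j) _)) ⟩
    sumℚ (λ j → ℤ→ℚ (e j ℤ.* lookup (w j) i))         ≡⟨ sumℚ-ℤ→ℚ (λ j → e j ℤ.* lookup (w j) i) ⟩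
    ℤ→ℚ (sumℤ λ j → e j ℤ.* lookup (w j) i)           ≡⟨ cong ℤ→ℚ (Vecₚ.lookup∘tabulate _ i) ⟨
    ℤ→ℚ (lookup (comb w e) i)                         ∎
    where open ≡-Reasoning

  Rep-zero : Rep w (λ _ → 0ℚ) (+ 0) (replicate N (+ 0))
  Rep-zero .height   = sumℚ-const-0 m
  Rep-zero .coords i = trans (sumℚ-cong λ j → ℚₚ.*-zeroˡ (ℤ→ℚ (lookup (w j) i)))
    (trans (sumℚ-const-0 m) (cong ℤ→ℚ (sym (Vecₚ.lookup-replicate i (+ 0)))))

  Rep-⊕ : ∀ {r s a b x y} → Rep w r a x → Rep w s b y → Rep w (λ j → r j ℚ.+ s j) (a ℤ.+ b) (x ⊕ y)
  Rep-⊕ {r} {s} {a} {b} p q .height =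
    trans (sumℚ-+ r s) (trans (cong₂ ℚ._+_ (p .height) (q .height)) (sym (ℤ→ℚ-+ a b)))
  Rep-⊕ {r} {s} {x = x} {y} p q .coords i = begin
    sumℚ (λ j → (r j ℚ.+ s j) ℚ.* ℤ→ℚ (lookup (w j) i))
      ≡⟨ sumℚ-cong (λ j → ℚₚ.*-distribʳ-+ (ℤ→ℚ (lookup (w j) i)) (r j) (s j)) ⟩
    sumℚ (λ j → r j ℚ.* ℤ→ℚ (lookup (w j) i) ℚ.+ s j ℚ.* ℤ→ℚ (lookup (w j) i))
      ≡⟨ sumℚ-+ {m} _ _ ⟩
    _
      ≡⟨ cong₂ ℚ._+_ (p .coords i) (q .coords i) ⟩
    ℤ→ℚ (lookup x i) ℚ.+ ℤ→ℚ (lookup y i)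
      ≡⟨ ℤ→ℚ-+ (lookup x i) (lookup y i) ⟨
    ℤ→ℚ (lookup x i ℤ.+ lookup y i)
      ≡⟨ cong ℤ→ℚ (Vecₚ.lookup-zipWith ℤ._+_ i x y) ⟨
    ℤ→ℚ (lookup (x ⊕ y) i)
      ∎
    where open ≡-Reasoning

  Rep-⊖ : ∀ {r s a b x y} → Rep w r a x → Rep w s b y → Rep w (λ j → r j ℚ.- s j) (a ℤ.- b) (x ⊖ y)
  Rep-⊖ {r} {s} {a} {b} p q .height =
    trans (sumℚ-- r s) (trans (cong₂ ℚ._-_ (p .height) (q .height)) (sym (ℤ→ℚ-- a b)))
  Rep-⊖ {r} {s} {x = x} {y} p q .coords i = begin
    sumℚ (λ j → (r j ℚ.- s j) ℚ.* ℤ→ℚ (lookup (w j) i))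
      ≡⟨ sumℚ-cong (λ j → solve 3 (λ a b c → (a :- b) :* c := a :* c :- b :* c) refl
           (r j) (s j) (ℤ→ℚ (lookup (w j) i))) ⟩
    sumℚ (λ j → r j ℚ.* ℤ→ℚ (lookup (w j) i) ℚ.- s j ℚ.* ℤ→ℚ (lookup (w j) i))
      ≡⟨ sumℚ-- {m} _ _ ⟩
    _
      ≡⟨ cong₂ ℚ._-_ (p .coords i) (q .coords i) ⟩
    ℤ→ℚ (lookup x i) ℚ.- ℤ→ℚ (lookup y i)
      ≡⟨ ℤ→ℚ-- (lookup x i) (lookup y i) ⟨
    ℤ→ℚ (lookup x i ℤ.- lookup y i)
      ≡⟨ cong ℤ→ℚ (Vecₚ.lookup-zipWith ℤ._-_ i x y) ⟨
    ℤ→ℚ (lookup (x ⊖ y) i)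
      ∎
    where
    open ≡-Reasoning
    open ℚ-Solver

  Rep-functional : ∀ {r s a b x y} → (∀ j → r j ≡ s j) → Rep w r a x → Rep w s b y → x ≡ y
  Rep-functional {x = x} {y} eq p q = Pointwiseₚ.Pointwise-≡⇒≡ (Pointwiseₚ.ext λ i →
    ℤ→ℚ-injective (trans (sym (p .coords i))
      (trans (sumℚ-cong λ j → cong (ℚ._* ℤ→ℚ (lookup (w j) i)) (eq j)) (q .coords i))))

  -- The difference of the two representations represents the origin at height 0.
  Rep-unique : Independent w → ∀ {r s n x} → Rep w r n x → Rep w s n x → ∀ j → r j ≡ s j
  Rep-unique ind {n = n} {x} p q j = q-p≡0⇒q≡p (ind _
    (trans (d .height) (cong ℤ→ℚ (ℤₚ.+-inverseʳ n)))
    (λ i → trans (d .coords i) 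
      (cong ℤ→ℚ (trans (Vecₚ.lookup-zipWith ℤ._-_ i x x) (ℤₚ.+-inverseʳ (lookup x i)))))
    j)
    where d = Rep-⊖ p q

  Rep-height-ℕ : ∀ {r n x} → (∀ j → 0ℚ ℚ.≤ r j) → Rep w r n x → ∃ λ k → n ≡ + k
  Rep-height-ℕ {n = n} 0≤r p = ℤ.∣ n ∣ , sym (ℤₚ.0≤i⇒+∣i∣≡i (ℤ→ℚ-reflects-≤
    (subst₂ ℚ._≤_ (sumℚ-const-0 m) (p .height) (sumℚ-mono-≤ 0≤r))))

  Rep-height-0 : ∀ {r x} → (∀ j → 0ℚ ℚ.≤ r j) → Rep w r (+ 0) x → ∀ j → r j ≡ 0ℚ
  Rep-height-0 0≤r p = sumℚ-zero⇒≡0 0≤r (p .height)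

-- The filtration from the cone to the box

module _ {m N : ℕ} (w : Verts m N) where

  -- Interpolates in `t`: nothing is bounded above at `t` = 0, where this is the whole cone, and `t`
  -- = `m` gives the box.
  Cone : ℕ → ℕ → Vec ℤ N → Set
  Cone t n x = Σ (Fin m → ℚ) λ r →
    (∀ j → 0ℚ ℚ.≤ r j) × (∀ j → toℕ j < t → r j ℚ.< 1ℚ) × Rep w r (+ n) x

  -- What is lost from `Cone` when the bound on the coefficient of index `k` is added.
  ConeBeyond : Fin m → ℕ → Vec ℤ N → Set
  ConeBeyond k n x = Σ (Fin m → ℚ) λ r →
    (∀ j → 0ℚ ℚ.≤ r j) × (∀ j → toℕ j < toℕ k → r j ℚ.< 1ℚ) × Rep w r (+ n) x × 1ℚ ℚ.≤ r k

  Box : ℕ → Vec ℤ N → Set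
  Box n x = Σ (Fin m → ℚ) λ r → (∀ j → 0ℚ ℚ.≤ r j × r j ℚ.< 1ℚ) × Rep w r (+ n) x

module _ {m N : ℕ} {w : Verts m N} where

  -- Nonnegative coefficients with sum 0 all vanish. This supplies the constant term 1 of the
  -- series, on which `IsEhrhart` is silent.
  Cone-0-0 : HasCard (Cone w 0 0) 1
  Cone-0-0 = replicate N (+ 0) ∷ [] , All.[] ∷ [] , refl , λ x →
    (λ { (here refl) → (λ _ → 0ℚ) , (λ _ → ℚₚ.≤-refl) , (λ _ ()) , Rep-zero }) ,
    (λ (r , 0≤r , _ , p) → here (Rep-functional (Rep-height-0 0≤r p) p Rep-zero))

  cone-step : ∀ k {n x} → Cone w (toℕ k) n x → Cone w (suc (toℕ k)) n x ⊎ ConeBeyond w k n x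
  cone-step k (r , 0≤r , r<1 , p) with r k ℚₚ.<? 1ℚ
  ... | no  rk≮1 = inj₂ (r , 0≤r , r<1 , p , ℚₚ.≮⇒≥ rk≮1)
  ... | yes rk<1 = inj₁ (r , 0≤r , bound , p)
    where
    bound : ∀ j → toℕ j < suc (toℕ k) → r j ℚ.< 1ℚ
    bound j (s≤s le) with ℕₚ.m≤n⇒m<n∨m≡n le
    ... | inj₁ lt = r<1 j lt
    ... | inj₂ eq = subst (λ i → r i ℚ.< 1ℚ) (sym (Finₚ.toℕ-injective eq)) rk<1

  -- Subtracting the vertex changes only coefficient `k`, which is at least 1 and so stays
  -- nonnegative. The target puts no upper bound on that coefficient, so `cone-up` is a full
  -- inverse.
  cone-down : ∀ k {n x} → ConeBeyond w k (suc n) x → Cone w (toℕ k) n (x ⊖ comb w (unit k))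
  cone-down k {n} {x} (r , 0≤r , r<1 , p , 1≤rk) = s , 0≤s , s<1 ,
    subst (λ h → Rep w s h _) (cong (ℤ._-_ (+ suc n)) (sumℤ-unit k)) (Rep-⊖ p (Rep-comb (unit k)))
    where
    s : Fin m → ℚ
    s j = r j ℚ.- ℤ→ℚ (unit k j)
    s≡r : ∀ j → j ≢ k → r j ≡ s j
    s≡r j j≢k = sym (trans (cong (λ z → r j ℚ.- ℤ→ℚ z) (unit-≢ k j j≢k)) (q-0≡q (r j)))
    0≤s : ∀ j → 0ℚ ℚ.≤ s j
    0≤s j with j Finₚ.≟ k
    ... | no  j≢k  = subst (0ℚ ℚ.≤_) (s≡r j j≢k) (0≤r j)
    ... | yes refl = 0≤q-p (subst (λ z → ℤ→ℚ z ℚ.≤ r k) (sym (unit-≡ k)) 1≤rk)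
    s<1 : ∀ j → toℕ j < toℕ k → s j ℚ.< 1ℚ
    s<1 j j<k = subst (ℚ._< 1ℚ) (s≡r j (ℕₚ.<⇒≢ j<k ∘ cong toℕ)) (r<1 j j<k)

  cone-up : ∀ k {n x} → Cone w (toℕ k) n x → ConeBeyond w k (suc n) (x ⊕ comb w (unit k))
  cone-up k {n} {x} (r , 0≤r , r<1 , p) = s , 0≤s , s<1 ,
    subst (λ h → Rep w s h _) (trans (cong (ℤ._+_ (+ n)) (sumℤ-unit k)) (cong +_ (ℕₚ.+-comm n 1)))
      (Rep-⊕ p (Rep-comb (unit k))) ,
    subst₂ ℚ._≤_ (ℚₚ.+-identityˡ 1ℚ) (cong (λ z → r k ℚ.+ ℤ→ℚ z) (sym (unit-≡ k))) (ℚₚ.+-monoˡ-≤ 1ℚ (0≤r k))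
    where
    s : Fin m → ℚ
    s j = r j ℚ.+ ℤ→ℚ (unit k j)
    s≡r : ∀ j → j ≢ k → r j ≡ s j
    s≡r j j≢k = sym (trans (cong (λ z → r j ℚ.+ ℤ→ℚ z) (unit-≢ k j j≢k)) (ℚₚ.+-identityʳ (r j)))
    0≤s : ∀ j → 0ℚ ℚ.≤ s j
    0≤s j with j Finₚ.≟ k
    ... | no  j≢k  = subst (0ℚ ℚ.≤_) (s≡r j j≢k) (0≤r j)
    ... | yes refl = ℚₚ.+-mono-≤ (0≤r k) (subst (λ z → 0ℚ ℚ.≤ ℤ→ℚ z) (sym (unit-≡ k)) 0≤1)
      where
      0≤1 : 0ℚ ℚ.≤ 1ℚ
      0≤1 = ℚₚ.nonNegative⁻¹ 1ℚ
    s<1 : ∀ j → toℕ j < toℕ k → s j ℚ.< 1ℚ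
    s<1 j j<k = subst (ℚ._< 1ℚ) (s≡r j (ℕₚ.<⇒≢ j<k ∘ cong toℕ)) (r<1 j j<k)

  ¬ConeBeyond-0 : ∀ k {x} → ¬ ConeBeyond w k 0 x
  ¬ConeBeyond-0 k (r , 0≤r , _ , p , 1≤rk) =
    <⇒≱ (ℚₚ.positive⁻¹ 1ℚ) (subst (1ℚ ℚ.≤_) (Rep-height-0 0≤r p k) 1≤rk)

-- Box points counted by iterated differences

module _ {m N : ℕ} {w : Verts m N} (ind : Independent w) {c : ℕ → ℕ} (ehr : IsEhrhart w c) where

  private
    Counts : ℕ → Set
    Counts t = Σ (ℕ → ℕ) λ f →
      (∀ n → HasCard (Cone w t n) (f n)) × (∀ n → + f n ≡ diffs t (ehrSeries c) n)

    counts-0 : Counts 0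
    counts-0 = f , card , eq
      where
      f : ℕ → ℕ
      f zero    = 1
      f (suc n) = c (suc n)
      card : ∀ n → HasCard (Cone w 0 n) (f n)
      card zero    = Cone-0-0
      card (suc n) = HasCard-map (λ x → x) (λ x → x) (λ _ → refl) (λ _ → refl)
        (λ (r , 0≤r , h , p) → r , 0≤r , (λ _ ()) , rep h p)
        (λ (r , 0≤r , _ , rep h p) → r , 0≤r , h , p) (ehr n)
      eq : ∀ n → + f n ≡ ehrSeries c n
      eq zero    = refl
      eq (suc n) = refl

    counts-suc : ∀ k → Counts (toℕ k) → Counts (suc (toℕ k))
    counts-suc k (f , card , eq) = (λ n → proj₁ (split n)) , (λ n → proj₁ (proj₂ (proj₂ (split n)))) ,
      λ n → let _ , _ , _ , hb , a+b≡f = split n in difference n hb a+b≡f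
      where
      split : ∀ n → ∃₂ λ a b → HasCard (Cone w (suc (toℕ k)) n) a × HasCard (ConeBeyond w k n) b × a + b ≡ f n
      split n = HasCard-split (cone-step k)
        (λ (r , 0≤r , r<1 , p) → r , 0≤r , (λ j lt → r<1 j (ℕₚ.m<n⇒m<1+n lt)) , p)
        (λ (r , 0≤r , r<1 , p , _) → r , 0≤r , r<1 , p)
        -- The two alternatives come with separate coefficient vectors; independence identifies
        -- them, so the split is disjoint.
        (λ (r , _ , r<1 , p) (s , _ , _ , q , 1≤sk) →
          <⇒≱ (r<1 k ℕₚ.≤-refl) (subst (1ℚ ℚ.≤_) (Rep-unique ind q p k) 1≤sk))
        (card n)

      difference : ∀ n {a b} → HasCard (ConeBeyond w k n) b → a + b ≡ f n →
        + a ≡ diff (diffs (toℕ k) (ehrSeries c)) n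
      difference zero {a} {b} hb a+b≡f = begin
        + a                                 ≡⟨ cong +_ (ℕₚ.+-identityʳ a) ⟨
        + (a + 0)                           ≡⟨ cong (λ z → + (a + z)) (HasCard-∅ (¬ConeBeyond-0 k) hb) ⟨
        + (a + b)                           ≡⟨ cong +_ a+b≡f ⟩
        + f 0                               ≡⟨ eq 0 ⟩
        diffs (toℕ k) (ehrSeries c) 0       ∎
        where open ≡-Reasoning
      difference (suc n) {a} {b} hb a+b≡f = begin
        + a                                 ≡⟨ solve 2 (λ x y → x := x :+ y :- y) refl (+ a) (+ b) ⟩
        + (a + b) ℤ.- + b                   ≡⟨ cong₂ (λ x y → + x ℤ.- + y) a+b≡f b≡f ⟩
        + f (suc n) ℤ.- + f n               ≡⟨ cong₂ ℤ._-_ (eq (suc n)) (eq n) ⟩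
        diff (diffs (toℕ k) (ehrSeries c)) (suc n)   ∎
        where
        open ≡-Reasoning
        open ℤ-Solver
        u = comb w (unit k)
        b≡f : b ≡ f n
        b≡f = HasCard-unique
          (HasCard-map (_⊖ u) (_⊕ u) (λ x → ⊖-⊕ x u) (λ x → ⊕-⊖ x u) (cone-down k) (cone-up k) hb) (card n)

    counts : ∀ t → t ≤ m → Counts t
    counts zero    _   = counts-0
    counts (suc t) t<m = subst (Counts ∘ suc) (Finₚ.toℕ-fromℕ< t<m)
      (counts-suc (fromℕ< t<m) (subst Counts (sym (Finₚ.toℕ-fromℕ< t<m)) (counts t (ℕₚ.<⇒≤ t<m))))

  box-counts : Σ (ℕ → ℕ) λ f → (∀ n → HasCard (Box w n) (f n)) × (∀ n → + f n ≡ diffs m (ehrSeries c) n)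
  box-counts with f , card , eq ← counts m ℕₚ.≤-refl = f ,
    (λ n → HasCard-map (λ x → x) (λ x → x) (λ _ → refl) (λ _ → refl)
      (λ (r , 0≤r , r<1 , p) → r , (λ j → 0≤r j , r<1 j (Finₚ.toℕ<n j)) , p)
      (λ (r , r∈ , p) → r , proj₁ ∘ r∈ , (λ j _ → proj₂ (r∈ j)) , p)
      (card n)) ,
    eq

diffs-at-0 : ∀ t g → diffs t g 0 ≡ g 0
diffs-at-0 zero    g = refl
diffs-at-0 (suc t) g = diffs-at-0 t g

-- All that the comparison of the conditions uses about a δ-vector, for the simplex and for its
-- facets alike.
record BoxCounts {m N : ℕ} (w : Verts m N) (δ : ℕ → ℤ) : Set where
  field
    count   : ℕ → ℕ
    card    : ∀ n → HasCard (Box w n) (count n)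
    δ≡count : ∀ n → δ n ≡ + count n
    count-0 : count 0 ≡ 1

delta-boxCounts : ∀ {e N} {w : Verts (suc e) N} → Independent w → ∀ {c} → IsEhrhart w c →
  BoxCounts w (delta c e)
delta-boxCounts {e} ind {c} ehr = let f , card , eq = box-counts ind ehr in record
  { count   = f
  ; card    = card
  ; δ≡count = λ n → trans (delta≡diffs c e n) (sym (eq n))
  ; count-0 = ℤₚ.+-injective (trans (eq 0) (diffs-at-0 (suc e) (ehrSeries c)))
  }

-- The height is a sum of `suc e` coefficients below 1; strictness is taken from the one at `zero`.
Rep-height-< : ∀ {e N} {w : Verts (suc e) N} {r n x} → (∀ j → r j ℚ.< 1ℚ) → Rep w r (+ n) x → n < suc e
Rep-height-< {e} r<1 p = ℤₚ.drop‿+<+ (ℤ→ℚ-reflects-< (subst₂ ℚ._<_ (p .height) (sumℚ-const-1 (suc e))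
  (sumℚ-mono-< (λ j → ℚₚ.<⇒≤ (r<1 j)) zero (r<1 zero))))

-- Reflection of box points

-- Holds vacuously at heights without box points.
Full : ∀ {m N} → Verts m N → ℕ → Set
Full {m} {N} w n = ∀ {r : Fin m → ℚ} {x : Vec ℤ N} →
  (∀ j → 0ℚ ℚ.≤ r j × r j ℚ.< 1ℚ) → Rep w r (+ n) x → ∀ j → 0ℚ ℚ.< r j

module _ {m N : ℕ} (w : Verts m N) where

  -- The sum of all vertices has every coefficient 1, so this is r ↦ 1 - r on coefficients.
  reflect : Vec ℤ N → Vec ℤ N
  reflect x = comb w (λ _ → + 1) ⊖ x

  reflect-involutive : ∀ x → reflect (reflect x) ≡ x
  reflect-involutive = ⊖-⊖ (comb w λ _ → + 1)

  Rep-reflect : ∀ {r n n′ x} → n + n′ ≡ m → Rep w r (+ n) x → Rep w (λ j → 1ℚ ℚ.- r j) (+ n′) (reflect x)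
  Rep-reflect {r} {n} {n′} {x} eq p =
    subst (λ h → Rep w (λ j → 1ℚ ℚ.- r j) h (reflect x)) height≡ (Rep-⊖ (Rep-comb λ _ → + 1) p)
    where
    open ℤ-Solver
    height≡ : sumℤ {m} (λ _ → + 1) ℤ.- + n ≡ + n′
    height≡ = trans (cong (ℤ._- + n) (trans (sumℤ-const-1 m) (cong +_ (sym eq))))
      (solve 2 (λ a b → a :+ b :- a := b) refl (+ n) (+ n′))

  -- Fullness is what keeps 1 - r strictly below 1.
  Box-reflect : ∀ {n n′ x} → n + n′ ≡ m → Full w n → Box w n x → Box w n′ (reflect x)
  Box-reflect eq full (r , r∈ , p) =
    _ , (λ j → 0≤q-p (ℚₚ.<⇒≤ (proj₂ (r∈ j))) , q-p<q (full r∈ p j)) , Rep-reflect eq p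

  Full⇒card≡ : ∀ {n n′ k l} → n + n′ ≡ m → Full w n → Full w n′ →
    HasCard (Box w n) k → HasCard (Box w n′) l → k ≡ l
  Full⇒card≡ {n} {n′} eq full full′ hk hl = HasCard-unique
    (HasCard-map reflect reflect reflect-involutive reflect-involutive
      (Box-reflect eq full) (Box-reflect (trans (ℕₚ.+-comm n′ n) eq) full′) hk) hl

  -- With equal counts the injective reflection is onto, so every coefficient at height `n′` is some
  -- 1 - r with r < 1, hence positive.
  Full-reflect : Independent w → ∀ {n n′ k} → n + n′ ≡ m → Full w n →
    HasCard (Box w n) k → HasCard (Box w n′) k → Full w n′
  Full-reflect ind eq full hk hk′ {s} {y} s∈ q j
    with x , (r , r∈ , p) , refl ← injection-surjective reflect
           (λ {x} {y} e → trans (sym (reflect-involutive x)) (trans (cong reflect e) (reflect-involutive y)))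
           (Box-reflect eq full) hk hk′ (s , s∈ , q)
    = subst (0ℚ ℚ.<_) (Rep-unique ind (Rep-reflect eq p) q j) (0<q-p (proj₂ (r∈ j)))

-- Agrees with ⌈ q ⌉ only for 0 ≤ q < 1.
ceil : ℚ → ℤ
ceil q with 0ℚ ℚₚ.<? q
... | yes _ = + 1
... | no  _ = + 0

-- The difference is the fractional part of -q.
ceil-sub : ∀ {q} → 0ℚ ℚ.≤ q × q ℚ.< 1ℚ → 0ℚ ℚ.≤ ℤ→ℚ (ceil q) ℚ.- q × ℤ→ℚ (ceil q) ℚ.- q ℚ.< 1ℚ
ceil-sub {q} (0≤q , q<1) with 0ℚ ℚₚ.<? q
... | yes 0<q = 0≤q-p (ℚₚ.<⇒≤ q<1) , q-p<q 0<q
... | no  0≮q rewrite 0≤∧≯0⇒≡0 0≤q 0≮q = ℚₚ.≤-refl , ℚₚ.positive⁻¹ 1ℚ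

ceil≤1 : ∀ q → ℤ→ℚ (ceil q) ℚ.≤ 1ℚ
ceil≤1 q with 0ℚ ℚₚ.<? q
... | yes _ = ℚₚ.≤-refl
... | no  _ = ℚₚ.nonNegative⁻¹ 1ℚ

ceil≡⇒≡0 : ∀ {q} → q ℚ.< 1ℚ → ℤ→ℚ (ceil q) ≡ q → q ≡ 0ℚ
ceil≡⇒≡0 {q} q<1 eq with 0ℚ ℚₚ.<? q
... | yes _ = ⊥-elim (ℚₚ.<⇒≢ q<1 (sym eq))
... | no  _ = sym eq


-- If rⱼ = 0, negating the point modulo the lattice spanned by the (wⱼ , 1) gives a box point of
-- height at most k whose j-th coefficient also vanishes.
Full-negate : ∀ {d N} {w : Verts (suc d) N} {h k} → suc h + k ≡ d →
  (∀ n → n < k → Full w (suc n)) → Full w (suc h)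
Full-negate {d} {N} {w} {h} {k} h+k≡d full {r} {x} r∈ p j with 0ℚ ℚₚ.<? r j
... | yes 0<rj = 0<rj
... | no  0≮rj = ⊥-elim (absurd (Rep-height-ℕ {w = w} (proj₁ ∘ s∈) q))
  where
  e : Fin (suc d) → ℤ
  e i = ceil (r i)
  s : Fin (suc d) → ℚ
  s i = ℤ→ℚ (e i) ℚ.- r i
  s∈ : ∀ i → 0ℚ ℚ.≤ s i × s i ℚ.< 1ℚ
  s∈ i = ceil-sub (r∈ i)
  q : Rep w s (sumℤ e ℤ.- + suc h) (comb w e ⊖ x)
  q = Rep-⊖ (Rep-comb e) p
  rj≡0 : r j ≡ 0ℚ
  rj≡0 = 0≤∧≯0⇒≡0 (proj₁ (r∈ j)) 0≮rj
  sj≡0 : s j ≡ 0ℚ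
  sj≡0 rewrite rj≡0 = refl
  -- Each entry of `e` is at most 1 and the `j`-th is 0, so the negated point has height at most d -
  -- `suc h` = `k`.
  e<1+d : sumℤ e ℤ.< + suc d
  e<1+d = ℤ→ℚ-reflects-< (subst₂ ℚ._<_ (sumℚ-ℤ→ℚ e) (sumℚ-const-1 (suc d))
    (sumℚ-mono-< (ceil≤1 ∘ r) j
      (subst (λ z → ℤ→ℚ (ceil z) ℚ.< 1ℚ) (sym rj≡0) (ℚₚ.positive⁻¹ 1ℚ))))
  absurd : ¬ ∃ λ n → sumℤ e ℤ.- + suc h ≡ + n
  -- At height 0 the negated point has all coefficients 0, so every `r i` equals its own `ceil` and,
  -- being below 1, vanishes; but the height of `p` is positive.
  absurd (zero , eq) = ℕₚ.1+n≢0 (ℤₚ.+-injective (ℤ→ℚ-injective {+ suc h} {+ 0}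
      (trans (sym (p .height)) (trans (sumℚ-cong r≡0) (sumℚ-const-0 (suc d))))))
    where
    r≡0 : ∀ i → r i ≡ 0ℚ
    r≡0 i = ceil≡⇒≡0 (proj₂ (r∈ i))
      (q-p≡0⇒q≡p (Rep-height-0 {w = w} (proj₁ ∘ s∈) (subst (λ z → Rep w s z (comb w e ⊖ x)) eq q) i))
  absurd (suc n , eq) = ℚₚ.<-irrefl (sym sj≡0) (full n n<k s∈ (subst (λ z → Rep w s z (comb w e ⊖ x)) eq q) j)
    where
    e≡ : sumℤ e ≡ + (suc n + suc h)
    e≡ = trans (sym (a-b+b≡a (sumℤ e) (+ suc h))) (cong (ℤ._+ + suc h) eq)
    n<k : n < k
    n<k = ℕₚ.+-cancelˡ-≤ (suc h) (suc n) k (subst₂ _≤_ (ℕₚ.+-comm (suc n) (suc h)) (sym h+k≡d)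
      (ℕₚ.≤-pred (ℤₚ.drop‿+<+ (subst (ℤ._< + suc d) e≡ e<1+d))))

-- Fullness spreads inwards from both ends of the range of heights, one height at each end per
-- round; after d rounds the upper range reaches down to height 1.
symmetric⇒Full : ∀ {d N} {w : Verts (suc d) N} → Independent w →
  (f : ℕ → ℕ) → (∀ n → HasCard (Box w n) (f n)) →
  (∀ a b → suc a + suc b ≡ suc d → f (suc a) ≡ f (suc b)) → ∀ n → Full w (suc n)
symmetric⇒Full {d} {w = w} ind f card f-sym n = proj₂ (outer d ℕₚ.≤-refl) (suc n)
  (subst (suc d ≤_) (sym (ℕₚ.+-suc d n)) (s≤s (ℕₚ.m≤m+n d n)))
  where
  -- After `k` rounds the heights 1, ..., `k` and all heights from d + 1 - `k` on are full.
  -- Initially only heights above d are covered, and these contain no box points.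
  outer : ∀ k → k ≤ d → (∀ n → n < k → Full w (suc n)) × (∀ n → suc d ≤ k + n → Full w n)
  outer zero    _   = (λ _ ()) , λ n d<n r∈ p → ⊥-elim (ℕₚ.<⇒≱ (Rep-height-< {w = w} (proj₂ ∘ r∈) p) d<n)
  outer (suc k) k<d
    with ih-lower , ih-upper ← outer k (ℕₚ.<⇒≤ k<d)
    with h , eq ← ℕₚ.m≤n⇒∃[o]m+o≡n k<d
    = lower , upper
    where
    eq′ : suc h + k ≡ d
    eq′ = trans (cong suc (ℕₚ.+-comm h k)) eq
    eq″ : suc h + suc k ≡ suc d
    eq″ = trans (ℕₚ.+-suc (suc h) k) (cong suc eq′)
    -- `suc h` is d - `k`, the next height from above. Its reflection is `suc k`, the next one from
    -- below.
    full-1+h : Full w (suc h)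
    full-1+h = Full-negate eq′ ih-lower
    full-1+k : Full w (suc k)
    full-1+k = Full-reflect w ind eq″ full-1+h (card (suc h))
      (subst (HasCard _) (sym (f-sym h k eq″)) (card (suc k)))
    lower : ∀ n → n < suc k → Full w (suc n)
    lower n (s≤s n≤k) with ℕₚ.m≤n⇒m<n∨m≡n n≤k
    ... | inj₁ n<k  = ih-lower n n<k
    ... | inj₂ refl = full-1+k
    upper : ∀ n → suc d ≤ suc k + n → Full w n
    upper n (s≤s d≤k+n) with ℕₚ.m≤n⇒m<n∨m≡n d≤k+n
    ... | inj₁ d<k+n = ih-upper n d<k+n
    ... | inj₂ d≡k+n = subst (Full w)
      (ℕₚ.+-cancelˡ-≡ k (suc h) n (trans (ℕₚ.+-comm k (suc h)) (trans eq′ d≡k+n))) full-1+h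

-- Facets

Rep-facet⁺ : ∀ {d} (v : Verts (suc d) d) k {r n x} → r k ≡ 0ℚ → Rep v r n x →
  Rep (facet v k) (r ∘ punchIn k) n x
Rep-facet⁺ v k {r} rk≡0 p = rep
  (trans (drop r rk≡0) (p .height))
  (λ i → trans (drop (λ j → r j ℚ.* ℤ→ℚ (lookup (v j) i)) 
    (trans (cong (ℚ._* ℤ→ℚ (lookup (v k) i)) rk≡0) (ℚₚ.*-zeroˡ (ℤ→ℚ (lookup (v k) i))))) (p .coords i))
  where
  drop : ∀ f → f k ≡ 0ℚ → sumℚ (f ∘ punchIn k) ≡ sumℚ f
  drop f fk≡0 = sym (trans (sumℚ-punchIn k f) (trans (cong (ℚ._+ sumℚ (f ∘ punchIn k)) fk≡0) (ℚₚ.+-identityˡ _)))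

extend : ∀ {d} → Fin (suc d) → (Fin d → ℚ) → Fin (suc d) → ℚ
extend k r = insertAt r k 0ℚ

extend-∀ : ∀ {d} (P : ℚ → Set) k (r : Fin d → ℚ) → P 0ℚ → (∀ j → P (r j)) → ∀ j → P (extend k r j)
extend-∀ P k r p0 pr j with k Finₚ.≟ j
... | yes refl = subst P (sym (insertAt-lookup r k 0ℚ)) p0
... | no  k≢j  = subst P (trans (sym (insertAt-punchIn r k 0ℚ (punchOut k≢j)))
                    (cong (extend k r) (Finₚ.punchIn-punchOut k≢j))) (pr (punchOut k≢j))

-- Used with `g` constantly 1 for heights and with `g` a vertex coordinate for positions.
sumℚ-extend : ∀ {d} k (r : Fin d → ℚ) (g : Fin (suc d) → ℚ) →
  sumℚ (λ j → extend k r j ℚ.* g j) ≡ sumℚ (λ j → r j ℚ.* g (punchIn k j))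
sumℚ-extend k r g = begin
  sumℚ (λ j → extend k r j ℚ.* g j)
    ≡⟨ sumℚ-punchIn k (λ j → extend k r j ℚ.* g j) ⟩
  extend k r k ℚ.* g k ℚ.+ sumℚ (λ j → extend k r (punchIn k j) ℚ.* g (punchIn k j))
    ≡⟨ cong₂ ℚ._+_ (trans (cong (ℚ._* g k) (insertAt-lookup r k 0ℚ)) (ℚₚ.*-zeroˡ (g k)))
                   (sumℚ-cong λ j → cong (ℚ._* g (punchIn k j)) (insertAt-punchIn r k 0ℚ j)) ⟩
  0ℚ ℚ.+ sumℚ (λ j → r j ℚ.* g (punchIn k j))
    ≡⟨ ℚₚ.+-identityˡ _ ⟩
  sumℚ (λ j → r j ℚ.* g (punchIn k j))
    ∎
  where open ≡-Reasoning

sumℚ-extend-1 : ∀ {d} k (r : Fin d → ℚ) → sumℚ (extend k r) ≡ sumℚ r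
sumℚ-extend-1 k r = trans (sumℚ-cong λ j → sym (ℚₚ.*-identityʳ (extend k r j)))
  (trans (sumℚ-extend k r (λ _ → 1ℚ)) (sumℚ-cong λ j → ℚₚ.*-identityʳ (r j)))

Rep-facet⁻ : ∀ {d} (v : Verts (suc d) d) k {r n x} → Rep (facet v k) r n x → Rep v (extend k r) n x
Rep-facet⁻ v k {r} p = rep (trans (sumℚ-extend-1 k r) (p .height))
  (λ i → trans (sumℚ-extend k r λ j → ℤ→ℚ (lookup (v j) i)) (p .coords i))

facet-independent : ∀ {d} {v : Verts (suc d) d} → Independent v → ∀ k → Independent (facet v k)
facet-independent {v = v} ind k r h p j = trans (sym (insertAt-punchIn r k 0ℚ j))
  (ind (extend k r) (trans (sumℚ-extend-1 k r) h)
    (λ i → trans (sumℚ-extend k r λ j → ℤ→ℚ (lookup (v j) i)) (p i)) (punchIn k j))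

-- The three conditions

-- The term at 0 already uses up the whole sum, and the others are natural numbers.
sum≡1⇒≡0 : ∀ e {δ : ℕ → ℤ} {f : ℕ → ℕ} → (∀ i → δ i ≡ + f i) → f 0 ≡ 1 →
  sumℤ≤ e δ ≡ + 1 → ∀ i → i < e → f (suc i) ≡ 0
sum≡1⇒≡0 e {δ} {f} δ≡f f0≡1 sum≡1 i i<e = tail≡0 e i i<e
    (ℕₚ.suc-injective (trans (cong (_+ tail e) (sym f0≡1)) (ℤₚ.+-injective (trans (sym (sum≡ e)) sum≡1))))
  where
  tail : ℕ → ℕ
  tail zero    = 0
  tail (suc e) = tail e + f (suc e)
  sum≡ : ∀ e → sumℤ≤ e δ ≡ + (f 0 + tail e)
  sum≡ zero    = trans (δ≡f 0) (cong +_ (sym (ℕₚ.+-identityʳ (f 0))))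
  sum≡ (suc e) = trans (cong₂ ℤ._+_ (sum≡ e) (δ≡f (suc e))) (cong +_ (ℕₚ.+-assoc (f 0) (tail e) (f (suc e))))
  tail≡0 : ∀ e i → i < e → tail e ≡ 0 → f (suc i) ≡ 0
  tail≡0 (suc e) i (s≤s i≤e) eq with ℕₚ.m≤n⇒m<n∨m≡n i≤e
  ... | inj₁ i<e  = tail≡0 e i i<e (ℕₚ.m+n≡0⇒m≡0 (tail e) eq)
  ... | inj₂ refl = ℕₚ.m+n≡0⇒n≡0 (tail e) eq

≡0⇒sum≡1 : ∀ e {δ : ℕ → ℤ} → δ 0 ≡ + 1 → (∀ i → i < e → δ (suc i) ≡ + 0) → sumℤ≤ e δ ≡ + 1
≡0⇒sum≡1 zero    δ0 δ≡0 = δ0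
≡0⇒sum≡1 (suc e) δ0 δ≡0 = cong₂ ℤ._+_ (≡0⇒sum≡1 e δ0 λ i i<e → δ≡0 i (ℕₚ.m<n⇒m<1+n i<e)) (δ≡0 e ℕₚ.≤-refl)

1+[a+b]∸a≡1+b : ∀ a b {e} → a + b ≡ e → suc e ∸ a ≡ suc b
1+[a+b]∸a≡1+b a b refl = trans (cong (_∸ a) (sym (ℕₚ.+-suc a b))) (ℕₚ.m+n∸m≡n a (suc b))

-- The smaller summand is at most half. Shifted symmetry is stated only for the lower half of the
-- indices; this extends it to all.
≤⌊/2⌋-either : ∀ {a b e} → a + b ≡ e → a ≤ ⌊ e /2⌋ ⊎ b ≤ ⌊ e /2⌋
≤⌊/2⌋-either {a} {b} refl with ℕₚ.≤-total a b
... | inj₁ a≤b = inj₁ (subst (_≤ ⌊ a + b /2⌋) (sym (ℕₚ.n≡⌊n+n/2⌋ a)) (ℕₚ.⌊n/2⌋-mono (ℕₚ.+-monoʳ-≤ a a≤b)))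
... | inj₂ b≤a = inj₂ (subst (_≤ ⌊ a + b /2⌋) (sym (ℕₚ.n≡⌊n+n/2⌋ b)) (ℕₚ.⌊n/2⌋-mono (ℕₚ.+-monoˡ-≤ b b≤a)))

-- The dimension is written `suc e` so that both the facet dimension and the bound in
-- `ShiftedSymmetric` reduce to expressions in `e`.
module Simplex (e : ℕ) (v : Verts (suc (suc e)) (suc e)) (ind : IsSimplex v) where

  -- The hub of the equivalences: each of the three conditions is compared with it. Height 0 is left
  -- out because its only box point is the origin.
  AllFull : Set
  AllFull = ∀ n → Full v (suc n)

  AllFull⇒CondIII : AllFull → CondIII v
  AllFull⇒CondIII full α n (r , r∈ , h , p) α≢0
    with Rep-height-ℕ {w = v} {n = n} {x = α} (proj₁ ∘ r∈) (rep h p)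
  ... | suc n′ , refl = r , (λ j → full n′ {x = α} r∈ (rep h p) j , proj₂ (r∈ j)) , h , p
  -- Height 0 forces the origin, which the hypothesis excludes.
  ... | zero   , refl = ⊥-elim (α≢0 (Rep-functional (Rep-height-0 {w = v} (proj₁ ∘ r∈) q) q Rep-zero , refl))
    where
    q : Rep v r (+ 0) α
    q = rep h p

  CondIII⇒AllFull : CondIII v → AllFull
  CondIII⇒AllFull cond n {r} {x} r∈ p j
    -- The condition provides some positive coefficients `s`; uniqueness makes them the given `r`.
    with s , s∈ , h , q ← cond x (+ suc n) (r , r∈ , p .height , p .coords) (λ ())
    = subst (0ℚ ℚ.<_) (Rep-unique ind {r = s} {x = x} (rep h q) p j) (proj₁ (s∈ j))

  module _ {δ : ℕ → ℤ} (counts : BoxCounts v δ) where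

    open BoxCounts counts

    -- The heights d - i and i + 1 add up to d + 1, the number of vertices, so reflection matches
    -- their box points.
    AllFull⇒ShiftedSymmetric : AllFull → ShiftedSymmetric δ (suc e)
    AllFull⇒ShiftedSymmetric full i i≤e/2 = begin
      δ (suc e ∸ i)     ≡⟨ cong δ (1+[a+b]∸a≡1+b i b i+b≡e) ⟩
      δ (suc b)         ≡⟨ δ≡count (suc b) ⟩
      + count (suc b)   ≡⟨ cong +_ (Full⇒card≡ v eq (full b) (full i) (card (suc b)) (card (suc i))) ⟩
      + count (suc i)   ≡⟨ δ≡count (suc i) ⟨
      δ (suc i)         ∎
      where
      open ≡-Reasoning
      b : ℕ
      b = e ∸ i
      i+b≡e : i + b ≡ e
      i+b≡e = ℕₚ.m+[n∸m]≡n (ℕₚ.≤-trans i≤e/2 (ℕₚ.⌊n/2⌋≤n e))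
      eq : suc b + suc i ≡ suc (suc e)
      eq = cong suc (trans (ℕₚ.+-comm b (suc i)) (cong suc i+b≡e))

    ShiftedSymmetric⇒AllFull : ShiftedSymmetric δ (suc e) → AllFull
    ShiftedSymmetric⇒AllFull δ-sym = symmetric⇒Full ind count card count-sym
      where
      half : ∀ a b → a + b ≡ e → a ≤ ⌊ e /2⌋ → count (suc b) ≡ count (suc a)
      half a b a+b≡e a≤ = ℤₚ.+-injective (begin
        + count (suc b)   ≡⟨ δ≡count (suc b) ⟨
        δ (suc b)         ≡⟨ cong δ (1+[a+b]∸a≡1+b a b a+b≡e) ⟨
        δ (suc e ∸ a)     ≡⟨ δ-sym a a≤ ⟩
        δ (suc a)         ≡⟨ δ≡count (suc a) ⟩
        + count (suc a)   ∎)
        where open ≡-Reasoning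
      count-sym : ∀ a b → suc a + suc b ≡ suc (suc e) → count (suc a) ≡ count (suc b)
      count-sym a b eq
        with a+b≡e ← ℕₚ.suc-injective (ℕₚ.suc-injective (trans (cong suc (sym (ℕₚ.+-suc a b))) eq))
        with ≤⌊/2⌋-either {a} {b} a+b≡e
      ... | inj₁ a≤ = sym (half a b a+b≡e a≤)
      ... | inj₂ b≤ = half b a (trans (ℕₚ.+-comm b a) a+b≡e) b≤

  module _ {δ : Fin (suc (suc e)) → ℕ → ℤ} (counts : ∀ k → BoxCounts (facet v k) (δ k)) where

    open module FacetCounts k = BoxCounts (counts k)

    -- A vanishing coefficient `r j` would give a box point of positive height in facet `j`, whose
    -- volume 1 is exhausted by the origin.
    facetVol≡1⇒AllFull : (∀ k → sumℤ≤ e (δ k) ≡ + 1) → AllFull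
    facetVol≡1⇒AllFull vol≡1 n {r} {x} r∈ p j with 0ℚ ℚₚ.<? r j
    ... | yes 0<rj = 0<rj
    ... | no  0≮rj = ⊥-elim (HasCard-0⇒∅ (subst (HasCard _) count≡0 (card j (suc n)))
                       (r ∘ punchIn j , r∈ ∘ punchIn j , q))
      where
      q : Rep (facet v j) (r ∘ punchIn j) (+ suc n) x
      q = Rep-facet⁺ v j (0≤∧≯0⇒≡0 (proj₁ (r∈ j)) 0≮rj) p
      count≡0 : count j (suc n) ≡ 0
      -- The volume sums only the indices up to `e`, so the height bound for facet points is needed
      -- here.
      count≡0 = sum≡1⇒≡0 e (δ≡count j) (count-0 j) (vol≡1 j) n
        (ℕₚ.≤-pred (Rep-height-< (proj₂ ∘ r∈ ∘ punchIn j) q))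

    -- A facet box point of positive height, extended by coefficient 0 at `k`, would be a box point
    -- of the simplex without full support.
    AllFull⇒facetVol≡1 : AllFull → ∀ k → sumℤ≤ e (δ k) ≡ + 1
    AllFull⇒facetVol≡1 full k = ≡0⇒sum≡1 e (trans (δ≡count k 0) (cong +_ (count-0 k)))
      λ i _ → trans (δ≡count k (suc i)) (cong +_ (HasCard-∅ (empty i) (card k (suc i))))
      where
      empty : ∀ i {x} → ¬ Box (facet v k) (suc i) x
      empty i (r , r∈ , p) = ℚₚ.<-irrefl (sym (insertAt-lookup r k 0ℚ)) (full i
        (extend-∀ (λ q → 0ℚ ℚ.≤ q × q ℚ.< 1ℚ) k r (ℚₚ.≤-refl , ℚₚ.positive⁻¹ 1ℚ) r∈)
        (Rep-facet⁻ v k p) k)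

theorem2p1 : (d : ℕ) → 1 ≤ d → (v : Verts (suc d) d) → IsSimplex v →
    (c : ℕ → ℕ) → IsEhrhart v c →
    (cf : Fin (suc d) → ℕ → ℕ) → (∀ k → IsEhrhart (facet v k) (cf k)) →
    (ShiftedSymmetric (delta c d) d ⇔ (∀ k → normVol (cf k) (d ∸ 1) ≡ + 1))
    × ((∀ k → normVol (cf k) (d ∸ 1) ≡ + 1) ⇔ CondIII v)
theorem2p1 (suc e) (s≤s _) v ind c ehr cf ehrs =
  mk⇔ (AllFull⇒facetVol≡1 facetCounts ∘ ShiftedSymmetric⇒AllFull counts)
      (AllFull⇒ShiftedSymmetric counts ∘ facetVol≡1⇒AllFull facetCounts) ,
  mk⇔ (AllFull⇒CondIII ∘ facetVol≡1⇒AllFull facetCounts)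
      (AllFull⇒facetVol≡1 facetCounts ∘ CondIII⇒AllFull)
  where
  open Simplex e v ind
  counts : BoxCounts v (delta c (suc e))
  counts = delta-boxCounts ind ehr
  facetCounts : ∀ k → BoxCounts (facet v k) (delta (cf k) e)
  facetCounts k = delta-boxCounts (facet-independent {v = v} ind k) (ehrs k)
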